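{- For every integer $k\ge 3$, every $2$-layer $k$-planar graph is $2$-layer $\left\lceil\frac{2}{3}k+2\right\rceil$-quasiplanar. Further, every $2$-layer $2$-planar graph is $2$-layer $3$-quasiplanar.
   Context: All graphs are finite and simple (no loops or parallel edges). A topological $2$-layer graph is a bipartite graph $G=(U\,\dot\cup\,V,E)$, $E\subseteq U\times V$, drawn in the plane so that the vertices of $U$ and of $V$ are distinct points on two horizontal lines $L_u$ and $L_v$, respectively, and edges are $y$-monotone Jordan arcs; the drawing is assumed simple, i.e. adjacent edges do not cross and independent edges cross at most once. Denote the vertices by $u_1,\dots,u_p$ along $L_u$ and $v_1,\dots,v_q$ along $L_v$ in left-to-right order. (Thus edges $(u_i,v_x)$ and $(u_j,v_y)$ with $i<j$ cross if and only if $x>y$.) A topological $2$-layer graph is $k$-planar if each edge is crossed at most $k$ times, and $h$-quasiplanar if there is no set of $h$ pairwise crossing edges. A bipartite graph is $2$-layer $k$-planar (respectively $2$-layer $h$-quasiplanar) if it is isomorphic to the underlying abstract graph of some topological $2$-layer $k$-planar (respectively $h$-quasiplanar) graph. -}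

module Defs where

open import Data.Empty using (⊥)
open import Data.Fin using (Fin; _<_)
open import Data.Fin.Properties using (_<?_; +↔⊎)
open import Data.List using (List; length; filter; allFin; cartesianProduct)
open import Data.Nat using (ℕ; _≤_)
import Data.Nat as ℕ
open import Data.Product using (Σ; ∃; _×_; _,_)
open import Data.Sum using (_⊎_; inj₁; inj₂)
open import Function.Bundles using (_↔_; _⇔_; Inverse)
open import Function.Properties.Inverse using (↔-sym)
open import Level using (0ℓ)
open import Relation.Binary using (Rel; REL; Symmetric; Irreflexive)
import Relation.Binary as B
open import Relation.Binary.PropositionalEquality using (_≡_; _≢_)
open import Relation.Nullary using (¬_; Dec; no)
open import Relation.Nullary.Decidable using (_×-dec_; _⊎-dec_)
import Relation.Unary as U

record Graph : Set₁ where
  field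
    Vertex  : Set
    finite  : ∃ λ n → Vertex ↔ Fin n
    Adj     : Rel Vertex 0ℓ
    adj?    : B.Decidable Adj
    symm    : Symmetric Adj
    irrefl  : Irreflexive _≡_ Adj

record _≅_ (G H : Graph) : Set where
  private
    module G = Graph G
    module H = Graph H
  field
    bijection : G.Vertex ↔ H.Vertex
    preserves : ∀ a b → G.Adj a b ⇔
                H.Adj (Inverse.to bijection a) (Inverse.to bijection b)

-- A simple drawing is recorded by the left-to-right orders of its two layers:
-- i : Fin p is the i-th vertex on L_u and x : Fin q the x-th vertex on L_v.
-- In a simple drawing by y-monotone arcs these orders determine which edges
-- cross, and every pair of orders is realised (by straight-line segments).
record TopologicalTwoLayerGraph : Set₁ where
  field
    p q : ℕ
    E   : REL (Fin p) (Fin q) 0ℓ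
    E?  : B.Decidable E

  Pair : Set
  Pair = Fin p × Fin q

  IsEdge : U.Pred Pair 0ℓ
  IsEdge (i , x) = E i x

  isEdge? : U.Decidable IsEdge
  isEdge? (i , x) = E? i x

  -- The strict inequalities make adjacent edges non-crossing.
  Crosses : Rel Pair 0ℓ
  Crosses (i , x) (j , y) = (i < j × y < x) ⊎ (j < i × x < y)

  crosses? : B.Decidable Crosses
  crosses? (i , x) (j , y) =
    ((i <? j) ×-dec (y <? x)) ⊎-dec ((j <? i) ×-dec (x <? y))

  edges : List Pair
  edges = filter isEdge? (cartesianProduct (allFin p) (allFin q))

  -- Independent edges cross at most once, so the number of crossings on e is
  -- the number of edges crossing e.
  crossings : Pair → ℕ
  crossings e = length (filter (crosses? e) edges)

  Planar : ℕ → Set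
  Planar k = ∀ e → IsEdge e → crossings e ≤ k

  -- Crosses is irreflexive, so pairwise crossing edges are distinct and e
  -- enumerates a set of exactly h edges.
  Quasiplanar : ℕ → Set
  Quasiplanar h =
    ¬ (∃ λ (e : Fin h → Pair) →
         (∀ a → IsEdge (e a)) × (∀ a b → a ≢ b → Crosses (e a) (e b)))

  underlying : Graph
  underlying = record
    { Vertex = Fin p ⊎ Fin q
    ; finite = p ℕ.+ q , ↔-sym +↔⊎
    ; Adj    = Adj
    ; adj?   = adj?
    ; symm   = λ {a} {b} → symm a b
    ; irrefl = λ {a} {b} → irrefl a b
    }
    where
    Adj : Rel (Fin p ⊎ Fin q) 0ℓ
    Adj (inj₁ i) (inj₂ x) = E i x
    Adj (inj₂ x) (inj₁ i) = E i x
    Adj (inj₁ _) (inj₁ _) = ⊥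
    Adj (inj₂ _) (inj₂ _) = ⊥

    adj? : B.Decidable Adj
    adj? (inj₁ i) (inj₂ x) = E? i x
    adj? (inj₂ x) (inj₁ i) = E? i x
    adj? (inj₁ _) (inj₁ _) = no λ ()
    adj? (inj₂ _) (inj₂ _) = no λ ()

    symm : ∀ a b → Adj a b → Adj b a
    symm (inj₁ _) (inj₂ _) e = e
    symm (inj₂ _) (inj₁ _) e = e

    irrefl : ∀ a b → a ≡ b → ¬ Adj a b
    irrefl (inj₁ _) (inj₂ _) ()
    irrefl (inj₂ _) (inj₁ _) ()
    irrefl (inj₁ _) (inj₁ _) _ ()
    irrefl (inj₂ _) (inj₂ _) _ ()

-- Bipartiteness of G is not assumed separately in the next two definitions: it
-- follows from the isomorphism.  The isomorphism is one of abstract graphs, so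
-- it need not respect any particular bipartition of G.
TwoLayerPlanar : ℕ → Graph → Set₁
TwoLayerPlanar k G =
  Σ TopologicalTwoLayerGraph λ D →
    let open TopologicalTwoLayerGraph D in (G ≅ underlying) × Planar k

TwoLayerQuasiplanar : ℕ → Graph → Set₁
TwoLayerQuasiplanar h G =
  Σ TopologicalTwoLayerGraph λ D →
    let open TopologicalTwoLayerGraph D in (G ≅ underlying) × Quasiplanar h

{-# OPTIONS --safe #-}

-- Order pairs by e ≺ f when e starts to the left and ends to the right of f, so
-- that two edges cross iff they are ≺-comparable and a set of h pairwise crossing
-- edges is a chain.  Suppose that each edge of the chain shares an end with some
-- edge outside it.  An edge adjacent to e agrees with e in one coordinate and
-- differs from it in the other, so it crosses all edges of the chain below e or all
-- those above e.  Hence each of the h − 2 inner edges of the chain yields an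
-- additional crossing on the least or on the greatest edge, and different inner
-- edges yield different ones.  These two edges carry at least 2 (h − 1) + (h − 2)
-- crossings together, so 3 h ≤ 2 k + 4.  Isolated edges are first moved to the
-- right end of the drawing, where they are not crossed at all.
module Submission where

open import Defs
open import Data.Fin as Fin using (Fin; zero; suc; toℕ; fromℕ<)
import Data.Fin.Properties as Fin
open import Data.Integer as ℤ using (+_; ∣_∣)
import Data.Integer.DivMod as ℤ
import Data.Integer.Properties as ℤ
open import Data.List
  using (List; []; _∷_; _++_; length; map; filter; allFin; lookup)
import Data.List.Extrema as Extrema
open import Data.List.Membership.Propositional using (_∈_; _∉_)
open import Data.List.Membership.Propositional.Properties
  using (∈-map⁺; ∈-map⁻; ∈-++⁺ˡ; ∈-++⁺ʳ; ∈-++⁻; ∈-filter⁺; ∈-filter⁻; ∈-allFin;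
         ∈-cartesianProduct⁺; ∈-lookup)
open import Data.List.Membership.Setoid.Properties using (index-injective)
open import Data.List.Properties using (length-map; length-++; length-tabulate)
open import Data.List.Relation.Binary.Subset.Propositional using (_⊆_)
import Data.List.Relation.Unary.All as All
open import Data.List.Relation.Unary.All.Properties using (¬Any⇒All¬)
open import Data.List.Relation.Unary.AllPairs using (_∷_)
open import Data.List.Relation.Unary.Any using (here; there; index)
open import Data.List.Relation.Unary.Unique.Propositional using (Unique)
open import Data.List.Relation.Unary.Unique.Propositional.Properties
  using (map⁺; ++⁺; allFin⁺; filter⁺)
open import Data.Nat as ℕ using (ℕ; zero; suc; _≤_; s≤s)
import Data.Nat.Properties as ℕ
open import Data.Nat.Solver using (module +-*-Solver)
open import Data.Product using (Σ; ∃; _×_; _,_; proj₁; proj₂)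
open import Data.Rational.Unnormalised
  using (↥_; ↧_; _/_; _+_; _*_; ceiling; floor; -_)
open import Data.Sum using (_⊎_; inj₁; inj₂; [_,_]′)
open import Data.Sum.Function.Propositional using (_⊎-↔_)
open import Data.Sum.Properties using (inj₁-injective; inj₂-injective)
open import Function using (_∘_; id; Injective)
open import Function.Bundles using (_↔_; mk↔ₛ′; mk⇔; Inverse; _⇔_)
open import Function.Construct.Composition using (_⇔-∘_; _↔-∘_)
open import Function.Properties.Inverse using (↔-sym)
open import Relation.Binary using (Rel; tri<; tri≈; tri>)
open import Relation.Binary.PropositionalEquality
open import Relation.Nullary using (¬_; yes; no; contradiction)
open import Relation.Nullary.Decidable using (_×-dec_; _⊎-dec_; ¬?; decidable-stable)
import Relation.Unary as U

-- Duplicate-free lists, inverses and sorting on finite sets.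

private
  variable
    A : Set
    n : ℕ

lookup-injective : {xs : List A} → Unique xs → Injective _≡_ _≡_ (lookup xs)
lookup-injective (x∉ ∷ xs!) {zero}  {zero}  eq = refl
lookup-injective (x∉ ∷ xs!) {zero}  {suc j} eq =
  contradiction eq (All.lookup x∉ (∈-lookup j))
lookup-injective (x∉ ∷ xs!) {suc i} {zero}  eq =
  contradiction (sym eq) (All.lookup x∉ (∈-lookup i))
lookup-injective (x∉ ∷ xs!) {suc i} {suc j} eq = cong suc (lookup-injective xs! eq)

unique-⊆⇒length≤ : {xs ys : List A} → Unique xs → xs ⊆ ys → length xs ≤ length ys
unique-⊆⇒length≤ {A = A} xs! xs⊆ys = Fin.injective⇒≤ {f = position} λ eq →
  lookup-injective xs! (index-injective (setoid A) _ _ eq)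
  where position = λ i → index (xs⊆ys (∈-lookup i))

-- If `y` were missed, then `y` and the `n` distinct values of `f` would form a duplicate-free list
-- of `suc n` elements of `Fin n`.
injective⇒inverse : {f : Fin n → Fin n} → Injective _≡_ _≡_ f →
                    Σ (Fin n ↔ Fin n) λ σ → ∀ y → f (Inverse.to σ y) ≡ y
injective⇒inverse {n} {f} inj =
  mk↔ₛ′ f⁻¹ f (λ i → inj (f∘f⁻¹ (f i))) f∘f⁻¹ , f∘f⁻¹
  where
  preimage : ∀ y → ∃ λ x → f x ≡ y
  preimage y with Fin.any? (λ x → f x Fin.≟ y)
  ... | yes found = found
  ... | no  ∄x    = contradiction too-long ℕ.1+n≰n
    where
    y∉ : y ∉ map f (allFin n)
    y∉ y∈ with x , _ , eq ← ∈-map⁻ f y∈ = ∄x (x , sym eq)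

    too-long : suc n ≤ n
    too-long = subst₂ _≤_
      (cong suc (trans (length-map f (allFin n)) (length-tabulate {n = n} id)))
      (length-tabulate {n = n} id)
      (unique-⊆⇒length≤ (¬Any⇒All¬ _ y∉ ∷ map⁺ inj (allFin⁺ n)) (λ _ → ∈-allFin _))

  f⁻¹ = proj₁ ∘ preimage
  f∘f⁻¹ = proj₂ ∘ preimage

-- `σ` runs from new positions to old vertices: position `a` holds `σ a`.
Sorts : (Fin n → ℕ) → Fin n ↔ Fin n → Set
Sorts κ σ = ∀ a b → a Fin.< b → κ (Inverse.to σ a) ℕ.< κ (Inverse.to σ b)

-- The rank of an element, the number of smaller keys, is injective; its inverse is the sorting
-- permutation.
sortByKey : (κ : Fin n → ℕ) → Injective _≡_ _≡_ κ → ∃ (Sorts κ)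
sortByKey {n} κ κ-inj = σ , sorted
  where
  below? : ∀ i → U.Decidable (λ j → κ j ℕ.< κ i)
  below? i j = κ j ℕ.<? κ i

  lower : Fin n → List (Fin n)
  lower i = filter (below? i) (allFin n)

  ∈-lower⁻ : ∀ {i j} → j ∈ lower i → κ j ℕ.< κ i
  ∈-lower⁻ {i} = proj₂ ∘ ∈-filter⁻ (below? i) {xs = allFin n}

  -- The additional entry `i` turns inclusions of lists into strict inequalities between ranks.
  lower! : ∀ i → Unique (i ∷ lower i)
  lower! i =
    ¬Any⇒All¬ _ (ℕ.<-irrefl refl ∘ ∈-lower⁻) ∷ filter⁺ (below? i) (allFin⁺ n)

  rank<n : ∀ i → length (lower i) ℕ.< n
  rank<n i = subst (length (lower i) ℕ.<_) (length-tabulate {n = n} id)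
    (unique-⊆⇒length≤ (lower! i) (λ _ → ∈-allFin _))

  rank : Fin n → Fin n
  rank i = fromℕ< (rank<n i)

  lower-mono : ∀ {i j} → κ i ℕ.< κ j → i ∷ lower i ⊆ lower j
  lower-mono {j = j} i<j (here refl) = ∈-filter⁺ (below? j) (∈-allFin _) i<j
  lower-mono {j = j} i<j (there l∈)  =
    ∈-filter⁺ (below? j) (∈-allFin _) (ℕ.<-trans (∈-lower⁻ l∈) i<j)

  rank-mono : ∀ {i j} → κ i ℕ.< κ j → rank i Fin.< rank j
  rank-mono i<j = subst₂ ℕ._<_ (sym (Fin.toℕ-fromℕ< _)) (sym (Fin.toℕ-fromℕ< _))
    (unique-⊆⇒length≤ (lower! _) (lower-mono i<j))

  rank-inj : Injective _≡_ _≡_ rank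
  rank-inj {i} {j} eq with ℕ.<-cmp (κ i) (κ j)
  ... | tri< i<j _ _ = contradiction (rank-mono i<j) (Fin.<-irrefl eq)
  ... | tri≈ _ i≡j _ = κ-inj i≡j
  ... | tri> _ _ j<i = contradiction (rank-mono j<i) (Fin.<-irrefl (sym eq))

  σ = proj₁ (injective⇒inverse rank-inj)
  rank∘σ = proj₂ (injective⇒inverse rank-inj)

  sorted : Sorts κ σ
  sorted a b a<b = ℕ.≰⇒> λ b≤a → [
      (λ κb<κa → Fin.<-asym a<b (subst₂ Fin._<_ (rank∘σ b) (rank∘σ a) (rank-mono κb<κa)))
    , (λ κb≡κa → Fin.<-irrefl
        (trans (sym (rank∘σ a)) (trans (cong rank (sym (κ-inj κb≡κa))) (rank∘σ b))) a<b)
    ]′ (ℕ.m≤n⇒m<n∨m≡n b≤a)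

module _ {m : ℕ} where
  open Extrema (Fin.≤-totalOrder m)

  minimiser : (f : Fin (suc n) → Fin m) → ∃ λ a → ∀ i → f a Fin.≤ f i
  minimiser f = argmin f zero (allFin _) ,
    λ i → All.lookup (f[argmin]≤f[xs] {f = f} zero (allFin _)) (∈-allFin i)

  maximiser : (f : Fin (suc n) → Fin m) → ∃ λ b → ∀ i → f i Fin.≤ f b
  maximiser f = argmax f zero (allFin _) ,
    λ i → All.lookup (f[xs]≤f[argmax] {f = f} zero (allFin _)) (∈-allFin i)

-- The order on edges and its interplay with adjacency.

module _ (D : TopologicalTwoLayerGraph) where
  open TopologicalTwoLayerGraph D

  infix 4 _≺_ _⊰_

  -- `⊰` orients adjacency: one of the two strict inequalities of `≺` becomes an equality. Distinct
  -- edges with a common end are related by it in one direction.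
  _≺_ _⊰_ : Rel Pair _
  (i , x) ≺ (j , y) = i Fin.< j × y Fin.< x
  (i , x) ⊰ (j , y) = (i ≡ j × y Fin.< x) ⊎ (i Fin.< j × y ≡ x)

  -- `≺` is strict in both coordinates, and a further weak step preserves this. In this way a
  -- neighbour inherits a crossing.
  ≺-trans-⊰ : ∀ {c d e} → c ≺ d → d ⊰ e → c ≺ e
  ≺-trans-⊰ (c<d , d<c) (inj₁ (refl , e<d)) = c<d , Fin.<-trans e<d d<c
  ≺-trans-⊰ (c<d , d<c) (inj₂ (d<e , refl)) = Fin.<-trans c<d d<e , d<c

  ⊰-trans-≺ : ∀ {c d e} → c ⊰ d → d ≺ e → c ≺ e
  ⊰-trans-≺ (inj₁ (refl , d<c)) (d<e , e<d) = d<e , Fin.<-trans e<d d<c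
  ⊰-trans-≺ (inj₂ (c<d , refl)) (d<e , e<d) = Fin.<-trans c<d d<e , e<d

  ⊰⇒¬crosses : ∀ {d e} → d ⊰ e → ¬ Crosses d e
  ⊰⇒¬crosses (inj₁ (refl , _)) (inj₁ (d<e , _)) = Fin.<-irrefl refl d<e
  ⊰⇒¬crosses (inj₁ (refl , _)) (inj₂ (e<d , _)) = Fin.<-irrefl refl e<d
  ⊰⇒¬crosses (inj₂ (_ , refl)) (inj₁ (_ , e<d)) = Fin.<-irrefl refl e<d
  ⊰⇒¬crosses (inj₂ (_ , refl)) (inj₂ (_ , d<e)) = Fin.<-irrefl refl d<e

  ⊰-irrefl : ∀ {e} → ¬ e ⊰ e
  ⊰-irrefl (inj₁ (_ , e<e)) = Fin.<-irrefl refl e<e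
  ⊰-irrefl (inj₂ (e<e , _)) = Fin.<-irrefl refl e<e

  crosses-irrefl : ∀ {e} → ¬ Crosses e e
  crosses-irrefl (inj₁ (e<e , _)) = Fin.<-irrefl refl e<e
  crosses-irrefl (inj₂ (e<e , _)) = Fin.<-irrefl refl e<e

  -- Were `d ≺ e`, then `e ⊰ f` would give `d ≺ f`, but the adjacent edges `d` and `f` do not cross.
  -- Hence `f` is an upper neighbour of at most one clique edge.
  common-upper : ∀ {d e f} → d ⊰ f → e ⊰ f → ¬ Crosses d e
  common-upper d⊰f e⊰f (inj₁ d≺e) = ⊰⇒¬crosses d⊰f (inj₁ (≺-trans-⊰ d≺e e⊰f))
  common-upper d⊰f e⊰f (inj₂ e≺d) = ⊰⇒¬crosses e⊰f (inj₁ (≺-trans-⊰ e≺d d⊰f))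

  common-lower : ∀ {d e f} → f ⊰ d → f ⊰ e → ¬ Crosses d e
  common-lower f⊰d f⊰e (inj₁ d≺e) = ⊰⇒¬crosses f⊰e (inj₁ (⊰-trans-≺ f⊰d d≺e))
  common-lower f⊰d f⊰e (inj₂ e≺d) = ⊰⇒¬crosses f⊰d (inj₁ (⊰-trans-≺ f⊰e e≺d))

  HasAdjacentEdge : U.Pred Pair _
  HasAdjacentEdge (i , x) = (∃ λ y → E i y × y ≢ x) ⊎ (∃ λ j → E j x × j ≢ i)

  hasAdjacentEdge? : U.Decidable HasAdjacentEdge
  hasAdjacentEdge? (i , x) =
    Fin.any? (λ y → E? i y ×-dec ¬? (y Fin.≟ x)) ⊎-dec
    Fin.any? (λ j → E? j x ×-dec ¬? (j Fin.≟ i))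

  adjacentEdge : ∀ {e} → HasAdjacentEdge e → ∃ λ f → IsEdge f × (e ⊰ f ⊎ f ⊰ e)
  adjacentEdge {i , x} (inj₁ (y , Eiy , y≢x)) with Fin.<-cmp x y
  ... | tri< x<y _ _ = (i , y) , Eiy , inj₂ (inj₁ (refl , x<y))
  ... | tri≈ _ x≡y _ = contradiction (sym x≡y) y≢x
  ... | tri> _ _ y<x = (i , y) , Eiy , inj₁ (inj₁ (refl , y<x))
  adjacentEdge {i , x} (inj₂ (j , Ejx , j≢i)) with Fin.<-cmp i j
  ... | tri< i<j _ _ = (j , x) , Ejx , inj₁ (inj₂ (i<j , refl))
  ... | tri≈ _ i≡j _ = contradiction (sym i≡j) j≢i
  ... | tri> _ _ j<i = (j , x) , Ejx , inj₂ (inj₂ (j<i , refl))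

  ∈-crossings : ∀ e {f} → IsEdge f → Crosses e f → f ∈ filter (crosses? e) edges
  ∈-crossings e Ef e×f = ∈-filter⁺ (crosses? e)
    (∈-filter⁺ isEdge? (∈-cartesianProduct⁺ (∈-allFin _) (∈-allFin _)) Ef) e×f

  -- Counting crossings on the extreme edges of a clique.

  PairwiseCrossing : ∀ {h} → (Fin h → Pair) → Set
  PairwiseCrossing e = ∀ a b → a ≢ b → Crosses (e a) (e b)

  Least Greatest : ∀ {h} → (Fin h → Pair) → Fin h → Set
  Least    e a = ∀ i → i ≢ a → e a ≺ e i
  Greatest e b = ∀ i → i ≢ b → e i ≺ e b

  -- Crossing edges have different first coordinates, whose order decides which edge is `≺`-smaller;
  -- so minimising the first coordinate suffices.
  least : ∀ {h} (e : Fin (suc h) → Pair) → PairwiseCrossing e → ∃ (Least e)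
  least e cross = let a , a≤ = minimiser (proj₁ ∘ e) in a , λ i i≢a →
    [ id , (λ (i<a , _) → contradiction (a≤ i) (ℕ.<⇒≱ i<a)) ]′ (cross a i (i≢a ∘ sym))

  greatest : ∀ {h} (e : Fin (suc h) → Pair) → PairwiseCrossing e → ∃ (Greatest e)
  greatest e cross = let b , ≤b = maximiser (proj₁ ∘ e) in b , λ i i≢b →
    [ id , (λ (b<i , _) → contradiction (≤b i) (ℕ.<⇒≱ b<i)) ]′ (cross i b i≢b)

  -- The list `used` has `3 * h` different slots, all of them in `slots`, whose length is four plus
  -- the crossings on `e a` and on `e b`.
  bound-from-extremes : ∀ {k h} → Planar k → (e : Fin h → Pair) →
                        (∀ a → IsEdge (e a)) → PairwiseCrossing e →
                        (∀ a → HasAdjacentEdge (e a)) →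
                        ∃ (Least e) → ∃ (Greatest e) → 3 ℕ.* h ≤ 4 ℕ.+ 2 ℕ.* k
  bound-from-extremes {k} {h} planar e Ee cross adjacent (a , a-least) (b , b-greatest) =
    bound
    where
    -- Slots for the crossings on e a (middle summand) and on e b (last summand);
    -- the first summand makes up for a and b, which are not inner edges, and each
    -- of e a and e b occupies a slot on itself.
    Slot : Set
    Slot = Fin h ⊎ Pair ⊎ Pair

    on-a on-b : Pair → Slot
    on-a = inj₂ ∘ inj₁
    on-b = inj₂ ∘ inj₂

    closedCrossings : Pair → List Pair
    closedCrossings c = c ∷ filter (crosses? c) edges

    -- Repetitions are harmless here, as when `h` is 1 and `a` and `b` coincide: distinctness
    -- matters for `used` only.
    slots : List Slot
    slots = inj₁ a ∷ inj₁ b ∷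
      (map on-a (closedCrossings (e a)) ++ map on-b (closedCrossings (e b)))

    a-slot : ∀ {f} → f ∈ closedCrossings (e a) → on-a f ∈ slots
    a-slot f∈ = there (there (∈-++⁺ˡ (∈-map⁺ on-a f∈)))

    b-slot : ∀ {f} → f ∈ closedCrossings (e b) → on-b f ∈ slots
    b-slot f∈ = there (there (∈-++⁺ʳ (map on-a (closedCrossings (e a))) (∈-map⁺ on-b f∈)))

    clique⊆closedCrossings : ∀ c i → e i ∈ closedCrossings (e c)
    clique⊆closedCrossings c i with i Fin.≟ c
    ... | yes refl = here refl
    ... | no  i≢c  = there (∈-crossings (e c) (Ee i) (cross c i (i≢c ∘ sym)))

    -- Records why `s` is given to `i`, in a form from which `i` can be recovered.
    Extra : Fin h → Slot → Set
    Extra i (inj₁ j)        = i ≡ j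
    Extra i (inj₂ (inj₁ f)) = e i ⊰ f
    Extra i (inj₂ (inj₂ f)) = f ⊰ e i

    extraSlot : ∀ i → ∃ λ s → s ∈ slots × Extra i s
    extraSlot i with i Fin.≟ a | i Fin.≟ b | adjacentEdge (adjacent i)
    ... | yes i≡a | _       | _ = inj₁ a , here refl , i≡a
    ... | no _    | yes i≡b | _ = inj₁ b , there (here refl) , i≡b
    ... | no i≢a  | no _    | f , Ef , inj₁ i⊰f = on-a f ,
      a-slot (there (∈-crossings (e a) Ef (inj₁ (≺-trans-⊰ (a-least i i≢a) i⊰f)))) , i⊰f
    ... | no _    | no i≢b  | f , Ef , inj₂ f⊰i = on-b f ,
      b-slot (there (∈-crossings (e b) Ef (inj₂ (⊰-trans-≺ f⊰i (b-greatest i i≢b))))) , f⊰i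

    crossing-or-equal : ∀ {i j} → ¬ Crosses (e i) (e j) → i ≡ j
    crossing-or-equal ¬i×j = decidable-stable (_ Fin.≟ _) (¬i×j ∘ cross _ _)

    extra-functional : ∀ {i j} s → Extra i s → Extra j s → i ≡ j
    extra-functional (inj₁ _) i≡l j≡l = trans i≡l (sym j≡l)
    extra-functional (inj₂ (inj₁ _)) i⊰f j⊰f = crossing-or-equal (common-upper i⊰f j⊰f)
    extra-functional (inj₂ (inj₂ _)) f⊰i f⊰j = crossing-or-equal (common-lower f⊰i f⊰j)

    -- Edges related by `⊰` do not cross, which inside the clique leaves only equality. This keeps
    -- the slots of neighbours apart from those of clique edges.
    clique-¬⊰ : ∀ {i j} → ¬ e i ⊰ e j
    clique-¬⊰ i⊰j with refl ← crossing-or-equal (⊰⇒¬crosses i⊰j) = ⊰-irrefl i⊰j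

    e-injective : ∀ {i j} → e i ≡ e j → i ≡ j
    e-injective eq = crossing-or-equal
      (λ i×j → crosses-irrefl (subst (λ c → Crosses c (e _)) eq i×j))

    extra : Fin h → Slot
    extra = proj₁ ∘ extraSlot

    extra-spec : ∀ i → Extra i (extra i)
    extra-spec = proj₂ ∘ proj₂ ∘ extraSlot

    images : (Fin h → Slot) → List Slot
    images g = map g (allFin h)

    used : List Slot
    used = images (on-a ∘ e) ++ images (on-b ∘ e) ++ images extra

    used! : Unique used
    used! =
      ++⁺ (map⁺ (e-injective ∘ inj₁-injective ∘ inj₂-injective) (allFin⁺ h))
        (++⁺ (map⁺ (e-injective ∘ inj₂-injective ∘ inj₂-injective) (allFin⁺ h))
          (map⁺ extra-injective (allFin⁺ h)) b#extra)
        a#rest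
      where
      extra-injective : ∀ {i j} → extra i ≡ extra j → i ≡ j
      extra-injective {i} {j} eq = extra-functional (extra j)
        (subst (Extra i) eq (extra-spec i)) (extra-spec j)

      b#extra : ∀ {s} → ¬ (s ∈ images (on-b ∘ e) × s ∈ images extra)
      b#extra (s∈b , s∈extra)
        with j , _ , refl ← ∈-map⁻ (on-b ∘ e) s∈b
           | i , _ , eq   ← ∈-map⁻ extra s∈extra
        -- Since `extra i` is `on-b (e j)`, its specification unfolds to `e j ⊰ e i`.
        = clique-¬⊰ (subst (Extra i) (sym eq) (extra-spec i))

      a#rest : ∀ {s} → ¬ (s ∈ images (on-a ∘ e) × s ∈ images (on-b ∘ e) ++ images extra)
      a#rest (s∈a , s∈rest)
        with j , _ , refl ← ∈-map⁻ (on-a ∘ e) s∈a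
           | ∈-++⁻ (images (on-b ∘ e)) s∈rest
      ... | inj₁ s∈b with () ← proj₂ (proj₂ (∈-map⁻ (on-b ∘ e) s∈b))
      ... | inj₂ s∈extra with i , _ , eq ← ∈-map⁻ extra s∈extra
        = clique-¬⊰ (subst (Extra i) (sym eq) (extra-spec i))

    used⊆slots : used ⊆ slots
    used⊆slots s∈ with ∈-++⁻ (images (on-a ∘ e)) s∈
    ... | inj₁ s∈a with i , _ , refl ← ∈-map⁻ (on-a ∘ e) s∈a =
      a-slot (clique⊆closedCrossings a i)
    ... | inj₂ s∈rest with ∈-++⁻ (images (on-b ∘ e)) s∈rest
    ...   | inj₁ s∈b with i , _ , refl ← ∈-map⁻ (on-b ∘ e) s∈b =
      b-slot (clique⊆closedCrossings b i)
    ...   | inj₂ s∈extra with i , _ , refl ← ∈-map⁻ extra s∈extra =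
      proj₁ (proj₂ (extraSlot i))

    length-images : ∀ g → length (images g) ≡ h
    length-images g = trans (length-map g (allFin h)) (length-tabulate {n = h} id)

    length-used : length used ≡ 3 ℕ.* h
    length-used = begin
      length used
        ≡⟨ length-++ (images (on-a ∘ e)) ⟩
      length (images (on-a ∘ e)) ℕ.+ length (images (on-b ∘ e) ++ images extra)
        ≡⟨ cong₂ ℕ._+_ (length-images (on-a ∘ e)) (length-++ (images (on-b ∘ e))) ⟩
      h ℕ.+ (length (images (on-b ∘ e)) ℕ.+ length (images extra))
        -- `3 * h` unfolds to `h + (h + (h + 0))`, hence the trailing zero.
        ≡⟨ cong (h ℕ.+_) (cong₂ ℕ._+_ (length-images (on-b ∘ e))
             (trans (length-images extra) (sym (ℕ.+-identityʳ h)))) ⟩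
      3 ℕ.* h ∎
      where open ≡-Reasoning

    length-slots : length slots ≡ 2 ℕ.+ (suc (crossings (e a)) ℕ.+ suc (crossings (e b)))
    length-slots = cong (2 ℕ.+_)
      (trans (length-++ (map on-a (closedCrossings (e a))))
        (cong₂ ℕ._+_ (length-map on-a (closedCrossings (e a)))
                     (length-map on-b (closedCrossings (e b)))))

    bound : 3 ℕ.* h ≤ 4 ℕ.+ 2 ℕ.* k
    bound = begin
      3 ℕ.* h                     ≡⟨ length-used ⟨
      length used                 ≤⟨ unique-⊆⇒length≤ used! used⊆slots ⟩
      length slots                ≡⟨ length-slots ⟩
      2 ℕ.+ (suc (crossings (e a)) ℕ.+ suc (crossings (e b)))
        ≤⟨ ℕ.+-monoʳ-≤ 2 (ℕ.+-mono-≤ (s≤s (planar _ (Ee a))) (s≤s (planar _ (Ee b)))) ⟩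
      2 ℕ.+ (suc k ℕ.+ suc k)
        ≡⟨ solve 1 (λ k → con 2 :+ (con 1 :+ k :+ (con 1 :+ k)) := con 4 :+ con 2 :* k)
             refl k ⟩
      4 ℕ.+ 2 ℕ.* k               ∎
      where
      open ℕ.≤-Reasoning
      open +-*-Solver

  clique-bound : ∀ {k h} → Planar k → (e : Fin h → Pair) →
                 (∀ a → IsEdge (e a)) → PairwiseCrossing e →
                 (∀ a → HasAdjacentEdge (e a)) → 3 ℕ.* h ≤ 4 ℕ.+ 2 ℕ.* k
  clique-bound {h = zero}  _      _ _  _     _        = ℕ.z≤n
  clique-bound {h = suc _} planar e Ee cross adjacent =
    bound-from-extremes planar e Ee cross adjacent (least e cross) (greatest e cross)

  -- Isolated edges, which are whole components, and the keys that move them.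

  Isolated : U.Pred Pair _
  Isolated e = IsEdge e × ¬ HasAdjacentEdge e

  isolated? : U.Decidable Isolated
  isolated? e = isEdge? e ×-dec ¬? (hasAdjacentEdge? e)

  isolated-uniqueᵥ : ∀ {i x y} → Isolated (i , x) → E i y → y ≡ x
  isolated-uniqueᵥ (_ , alone) Eiy =
    decidable-stable (_ Fin.≟ _) (λ y≢x → alone (inj₁ (_ , Eiy , y≢x)))

  isolated-uniqueᵤ : ∀ {i j x} → Isolated (i , x) → E j x → j ≡ i
  isolated-uniqueᵤ (_ , alone) Ejx =
    decidable-stable (_ Fin.≟ _) (λ j≢i → alone (inj₂ (_ , Ejx , j≢i)))

  -- Both ends of an isolated edge get the same key, which exceeds the keys of all
  -- vertices that are not on isolated edges.
  shift : Fin p → ℕ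
  shift i = (p ℕ.+ q) ℕ.+ toℕ i

  shift-injective : ∀ {i j} → shift i ≡ shift j → i ≡ j
  shift-injective = Fin.toℕ-injective ∘ ℕ.+-cancelˡ-≡ (p ℕ.+ q) _ _

  toℕᵤ<shift : ∀ (i j : Fin p) → toℕ i ℕ.< shift j
  toℕᵤ<shift i j =
    ℕ.<-≤-trans (Fin.toℕ<n i) (ℕ.≤-trans (ℕ.m≤m+n p q) (ℕ.m≤m+n (p ℕ.+ q) (toℕ j)))

  toℕᵥ<shift : ∀ (x : Fin q) (j : Fin p) → toℕ x ℕ.< shift j
  toℕᵥ<shift x j =
    ℕ.<-≤-trans (Fin.toℕ<n x) (ℕ.≤-trans (ℕ.m≤n+m q p) (ℕ.m≤m+n (p ℕ.+ q) (toℕ j)))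

  κᵤ : Fin p → ℕ
  κᵤ i with Fin.any? (λ x → isolated? (i , x))
  ... | yes _ = shift i
  ... | no  _ = toℕ i

  κᵥ : Fin q → ℕ
  κᵥ x with Fin.any? (λ i → isolated? (i , x))
  ... | yes (i , _) = shift i
  ... | no  _       = toℕ x

  κᵤ-injective : Injective _≡_ _≡_ κᵤ
  κᵤ-injective {i} {j} eq
    with Fin.any? (λ x → isolated? (i , x)) | Fin.any? (λ x → isolated? (j , x))
  ... | yes _ | yes _ = shift-injective eq
  ... | yes _ | no  _ = contradiction (toℕᵤ<shift j i) (ℕ.<-irrefl (sym eq))
  ... | no  _ | yes _ = contradiction (toℕᵤ<shift i j) (ℕ.<-irrefl eq)
  ... | no  _ | no  _ = Fin.toℕ-injective eq

  κᵥ-injective : Injective _≡_ _≡_ κᵥ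
  κᵥ-injective {x} {y} eq
    with Fin.any? (λ i → isolated? (i , x)) | Fin.any? (λ i → isolated? (i , y))
  -- Equal shifts identify the first ends, and an isolated edge is the only edge at its first end.
  ... | yes (i , Iix) | yes (j , Ijy) with refl ← shift-injective {i} {j} eq =
    isolated-uniqueᵥ Ijy (proj₁ Iix)
  ... | yes (i , _) | no  _ = contradiction (toℕᵥ<shift y i) (ℕ.<-irrefl (sym eq))
  ... | no  _ | yes (j , _) = contradiction (toℕᵥ<shift x j) (ℕ.<-irrefl eq)
  ... | no  _ | no  _ = Fin.toℕ-injective eq

  keys-isolated : ∀ {i x} → Isolated (i , x) → κᵤ i ≡ shift i × κᵥ x ≡ shift i
  keys-isolated {i} {x} Iix = keyᵤ , keyᵥ
    where
    keyᵤ : κᵤ i ≡ shift i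
    keyᵤ with Fin.any? (λ y → isolated? (i , y))
    ... | yes _ = refl
    ... | no ∄y = contradiction (x , Iix) ∄y

    keyᵥ : κᵥ x ≡ shift i
    keyᵥ with Fin.any? (λ j → isolated? (j , x))
    -- The search may have found another witness `j`; isolation forces it to be `i`.
    ... | yes (j , Ijx) = cong shift (isolated-uniqueᵤ Iix (proj₁ Ijx))
    ... | no ∄j = contradiction (i , Iix) ∄j

  -- An isolated edge at `i` or at `x` would have to be `(i , x)` itself, which has a neighbour; so
  -- both ends keep their old positions as keys.
  keys-adjacent : ∀ {i x} → E i x → HasAdjacentEdge (i , x) →
                  κᵤ i ≡ toℕ i × κᵥ x ≡ toℕ x
  keys-adjacent {i} {x} Eix adjacent = keyᵤ , keyᵥ
    where
    keyᵤ : κᵤ i ≡ toℕ i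
    keyᵤ with Fin.any? (λ y → isolated? (i , y))
    ... | yes (y , Iiy) with refl ← isolated-uniqueᵥ Iiy Eix =
      contradiction adjacent (proj₂ Iiy)
    ... | no _ = refl

    keyᵥ : κᵥ x ≡ toℕ x
    keyᵥ with Fin.any? (λ j → isolated? (j , x))
    ... | yes (j , Ijx) with refl ← isolated-uniqueᵤ Ijx Eix =
      contradiction adjacent (proj₂ Ijx)
    ... | no _ = refl

  -- Isolated edges are uncrossed in key order. Against another edge, the larger keys of both ends
  -- put the isolated edge entirely to the right; two isolated edges compare the same two shifts at
  -- both ends, so the inequalities contradict each other.
  key-≺⇒≺ : ∀ {i x j y} → E i x → E j y → κᵤ i ℕ.< κᵤ j → κᵥ y ℕ.< κᵥ x →
            (HasAdjacentEdge (i , x) × HasAdjacentEdge (j , y)) × (i , x) ≺ (j , y)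
  key-≺⇒≺ {i} {x} {j} {y} Eix Ejy i<j y<x
    with hasAdjacentEdge? (i , x) | hasAdjacentEdge? (j , y)
  ... | yes Aix | yes Ajy
    with κi , κx ← keys-adjacent Eix Aix | κj , κy ← keys-adjacent Ejy Ajy =
    (Aix , Ajy) , subst₂ ℕ._<_ κi κj i<j , subst₂ ℕ._<_ κy κx y<x
  ... | yes Aix | no ¬Ajy
    with _ , κx ← keys-adjacent Eix Aix | _ , κy ← keys-isolated (Ejy , ¬Ajy) =
    contradiction (toℕᵥ<shift x j) (ℕ.<-asym (subst₂ ℕ._<_ κy κx y<x))
  ... | no ¬Aix | yes Ajy
    with κi , _ ← keys-isolated (Eix , ¬Aix) | κj , _ ← keys-adjacent Ejy Ajy =
    contradiction (toℕᵤ<shift j i) (ℕ.<-asym (subst₂ ℕ._<_ κi κj i<j))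
  ... | no ¬Aix | no ¬Ajy
    with κi , κx ← keys-isolated (Eix , ¬Aix) | κj , κy ← keys-isolated (Ejy , ¬Ajy) =
    contradiction (subst₂ ℕ._<_ κi κj i<j) (ℕ.<-asym (subst₂ ℕ._<_ κy κx y<x))

  -- The redrawn graph and its quasiplanarity.

  relabel : Fin p ↔ Fin p → Fin q ↔ Fin q → TopologicalTwoLayerGraph
  relabel σ τ = record
    { p  = p
    ; q  = q
    ; E  = λ i x → E (Inverse.to σ i) (Inverse.to τ x)
    ; E? = λ i x → E? (Inverse.to σ i) (Inverse.to τ x)
    }

  -- Since `σ` and `τ` lead from new positions to old vertices, the isomorphism continues with their
  -- inverses.
  ≅-relabel : ∀ {G} σ τ → G ≅ underlying →
              G ≅ TopologicalTwoLayerGraph.underlying (relabel σ τ)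
  ≅-relabel {G} σ τ G≅D = record
    { bijection = ↔-sym (σ ⊎-↔ τ) ↔-∘ bijection
    ; preserves = λ a b → relabel-adj (to bijection a) (to bijection b) ⇔-∘ preserves a b
    }
    where
    open _≅_ G≅D
    open Inverse
    module D = Graph underlying
    module D′ = Graph (TopologicalTwoLayerGraph.underlying (relabel σ τ))

    E⇔ : ∀ i x → E i x ⇔ E (to σ (from σ i)) (to τ (from τ x))
    E⇔ i x = mk⇔ (subst₂ E (sym (strictlyInverseˡ σ i)) (sym (strictlyInverseˡ τ x)))
                 (subst₂ E (strictlyInverseˡ σ i) (strictlyInverseˡ τ x))

    relabel-adj : ∀ a b → D.Adj a b ⇔ D′.Adj (from (σ ⊎-↔ τ) a) (from (σ ⊎-↔ τ) b)
    relabel-adj (inj₁ i) (inj₁ j) = mk⇔ id id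
    relabel-adj (inj₁ i) (inj₂ x) = E⇔ i x
    relabel-adj (inj₂ x) (inj₁ i) = E⇔ i x
    relabel-adj (inj₂ x) (inj₂ y) = mk⇔ id id

  -- A clique of the new drawing pulls back to one of `D` whose edges all have neighbours, so
  -- `clique-bound` applies with the crossings of `D`.
  relabel-quasiplanar : ∀ {k h} σ τ → Sorts κᵤ σ → Sorts κᵥ τ →
                        Planar k → 5 ℕ.+ 2 ℕ.* k ≤ 3 ℕ.* h →
                        TopologicalTwoLayerGraph.Quasiplanar (relabel σ τ) h
  relabel-quasiplanar {k} {h} σ τ σ-sorts τ-sorts planar large (e , Ee , cross) =
    contradiction (clique-bound planar e′ Ee cross′ adjacent′) (ℕ.<⇒≱ large)
    where
    e′ : Fin h → Pair
    e′ a = Inverse.to σ (proj₁ (e a)) , Inverse.to τ (proj₂ (e a))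

    crossing : ∀ a b → a ≢ b →
               (HasAdjacentEdge (e′ a) × HasAdjacentEdge (e′ b)) × Crosses (e′ a) (e′ b)
    crossing a b a≢b with cross a b a≢b
    ... | inj₁ (u , v)
      with adj , a≺b ← key-≺⇒≺ (Ee a) (Ee b) (σ-sorts _ _ u) (τ-sorts _ _ v)
      = adj , inj₁ a≺b
    ... | inj₂ (u , v)
      with (adj-b , adj-a) , b≺a ← key-≺⇒≺ (Ee b) (Ee a) (σ-sorts _ _ u) (τ-sorts _ _ v)
      = (adj-a , adj-b) , inj₂ b≺a

    cross′ : PairwiseCrossing e′
    cross′ a b = proj₂ ∘ crossing a b

    -- That a clique edge has a neighbour is read off from its crossing with a second one, so the
    -- clique must contain two edges.
    two-edges : 2 ≤ h
    two-edges = ℕ.*-cancelˡ-< 3 1 h (ℕ.≤-trans (ℕ.m≤m+n 4 (1 ℕ.+ 2 ℕ.* k)) large)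

    other : ∀ {m} → 2 ≤ m → (c : Fin m) → ∃ λ d → d ≢ c
    other (s≤s (s≤s _)) zero    = suc zero , λ ()
    other (s≤s (s≤s _)) (suc _) = zero , λ ()

    adjacent′ : ∀ a → HasAdjacentEdge (e′ a)
    adjacent′ a with b , b≢a ← other two-edges a = proj₁ (proj₁ (crossing a b (b≢a ∘ sym)))

-- The numerical hypothesis is the exact negation of the inequality in `clique-bound`.
planar⇒quasiplanar : ∀ {k h G} → 5 ℕ.+ 2 ℕ.* k ≤ 3 ℕ.* h →
                     TwoLayerPlanar k G → TwoLayerQuasiplanar h G
planar⇒quasiplanar {G = G} large (D , G≅D , planar) =
  let σ , σ-sorts = sortByKey (κᵤ D) (κᵤ-injective D)
      τ , τ-sorts = sortByKey (κᵥ D) (κᵥ-injective D)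
  in relabel D σ τ , ≅-relabel D {G} σ τ G≅D ,
     relabel-quasiplanar D σ τ σ-sorts τ-sorts planar large

-- Arithmetic of the ceiling.

↥≤ceiling*↧ : ∀ r → ↥ r ℤ.≤ ceiling r ℤ.* ↧ r
↥≤ceiling*↧ r@record{} = begin
  ↥ r                          ≡⟨ ℤ.neg-involutive (↥ r) ⟨
  -- `ceiling r` is defined as the negative of `floor (- r)`, so the bound for floor division is
  -- applied to `- r` and negated.
  ℤ.- (↥ (- r))                ≤⟨ ℤ.neg-mono-≤ (ℤ.[n/d]*d≤n (↥ (- r)) (↧ r)) ⟩
  ℤ.- (floor (- r) ℤ.* ↧ r)    ≡⟨ ℤ.neg-distribˡ-* (floor (- r)) (↧ r) ⟩
  ceiling r ℤ.* ↧ r            ∎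
  where open ℤ.≤-Reasoning

i≤∣i∣ : ∀ i → i ℤ.≤ + ∣ i ∣
i≤∣i∣ (+ n)        = ℤ.≤-refl
i≤∣i∣ ℤ.-[1+ n ]  = ℤ.-≤+

-- Unnormalised fractions keep their denominators: `r` has numerator `2 * k * 1 + 6` and denominator
-- 3. The absolute value can only enlarge the ceiling.
6+2k≤3⌈⅔k+2⌉ : ∀ k →
  6 ℕ.+ 2 ℕ.* k ≤ 3 ℕ.* ∣ ceiling ((+ 2 / 3) * (+ k / 1) + (+ 2 / 1)) ∣
6+2k≤3⌈⅔k+2⌉ k = ℤ.drop‿+≤+ (begin
  + (6 ℕ.+ 2 ℕ.* k)      ≡⟨ cong +_ (ℕ.+-comm 6 (2 ℕ.* k)) ⟩
  + (2 ℕ.* k) ℤ.+ + 6    ≡⟨ cong (ℤ._+ + 6) (trans (ℤ.pos-* 2 k) (sym (ℤ.*-identityʳ _))) ⟩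
  ↥ r                    ≤⟨ ↥≤ceiling*↧ r ⟩
  ceiling r ℤ.* + 3      ≤⟨ ℤ.*-monoʳ-≤-nonNeg (+ 3) (i≤∣i∣ (ceiling r)) ⟩
  + ∣ ceiling r ∣ ℤ.* + 3  ≡⟨ ℤ.pos-* ∣ ceiling r ∣ 3 ⟨
  + (∣ ceiling r ∣ ℕ.* 3)  ≡⟨ cong +_ (ℕ.*-comm ∣ ceiling r ∣ 3) ⟩
  + (3 ℕ.* ∣ ceiling r ∣)  ∎)
  where
  open ℤ.≤-Reasoning
  r = (+ 2 / 3) * (+ k / 1) + (+ 2 / 1)

theorem13 : ((k : ℕ) → 3 ≤ k → (G : Graph) → TwoLayerPlanar k G →
    TwoLayerQuasiplanar ∣ ceiling ((+ 2 / 3) * (+ k / 1) + (+ 2 / 1)) ∣ G)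
    × ((G : Graph) → TwoLayerPlanar 2 G → TwoLayerQuasiplanar 3 G)
theorem13 =
  (λ k _ _ → planar⇒quasiplanar (ℕ.≤-trans (ℕ.n≤1+n _) (6+2k≤3⌈⅔k+2⌉ k))) ,
  -- For `k = 2` and `h = 3` both sides of the hypothesis equal 9.
  (λ _ → planar⇒quasiplanar ℕ.≤-refl)
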